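{- The category $\mathbf{KS}_{\mathrm{Scott}}$ of Kegelspitzen and Scott-continuous maps is cartesian closed.
   Context: A convex set is a set $X$ with, for each vector $\vec r=(r_1,\dots,r_m)$ of non-negative reals with $\sum_i r_i=1$, an operation $X^m\to X$, $(x_i)_i\mapsto\sum_i r_i\cdot x_i$, such that $\sum_j \delta_{ij}\cdot x_j=x_i$ (with $\delta_{ij}$ the Kronecker delta) and $\sum_i r_i\cdot(\sum_j s_{i,j}\cdot x_j)=\sum_j(\sum_i r_i s_{i,j})\cdot x_j$ for every $m\times n$ matrix $(s_{i,j})$ of non-negative reals with $\sum_j s_{i,j}=1$ for each $i$. Write $x\oplus_\lambda y=\lambda\cdot x+(1-\lambda)\cdot y$ for $\lambda\in[0,1]$. A convex dcpo is a convex set with a dcpo structure such that all the operations $X^m\to X$ are Scott-continuous. A pointed convex dcpo is a convex dcpo with a least element $\perp$, which serves as zero element of the convex structure: for non-negative $r_i$ with $\sum_i r_i\le 1$ one sets $\sum_i r_i\cdot x_i:=\sum_i r_i\cdot x_i+(1-\sum_i r_i)\cdot\perp$. A Kegelspitze is a pointed convex dcpo $X$ such that the scalar multiplication $[0,1]\times X\to X$, $\lambda\cdot x=x\oplus_\lambda\perp$, is Scott-continuous in both arguments. In $\mathbf{KS}_{\mathrm{Scott}}$ the morphisms are all Scott-continuous maps between Kegelspitzen; they need not be affine and need not preserve least elements. -}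

module Defs where

open import Level using (Level; _⊔_; 0ℓ) renaming (suc to lsuc)
open import Algebra.Bundles using (CommutativeRing)
import Algebra.Properties.Semiring.Sum as SemiringSum
open import Data.Bool.Base using (if_then_else_; true; false)
open import Data.Fin.Base using (Fin; zero; suc)
import Data.Fin.Properties as Fin
open import Data.Nat.Base as ℕ using (ℕ)
import Data.Nat.Properties as ℕ
open import Data.Product.Base using (Σ; ∃; _×_; _,_; proj₁; proj₂)
open import Data.Rational.Base as ℚ using (ℚ; 0ℚ; 1ℚ; ½; ∣_∣)
import Data.Rational.Properties as ℚ
open import Data.Rational.Solver using (module +-*-Solver)
open import Data.Sum.Base using (inj₁; inj₂)
open import Data.Vec.Functional using (Vector; []; _∷_)
open import Data.Vec.Functional.Relation.Binary.Pointwise using (Pointwise)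
import Data.Vec.Functional.Relation.Binary.Pointwise.Properties as Pointwise
open import Function.Base using (id; _∘_)
open import Relation.Binary.Bundles using (Setoid; Poset)
import Relation.Binary.Construct.On as On
open import Relation.Binary.Definitions using (Minimum)
open import Relation.Binary.Morphism.Structures using (IsOrderHomomorphism)
open import Relation.Binary.PropositionalEquality.Core as ≡ using (_≡_)
open import Relation.Binary.Structures using (IsEquivalence; IsPartialOrder)
open import Relation.Nullary.Decidable.Core using (does)

-- Real numbers are Cauchy sequences of rationals, with equality up to null
-- sequences; under excluded middle these are the classical reals.

private
  Eventually : (ℕ → Set) → Set
  Eventually P = ∃ λ N → ∀ n → N ℕ.≤ n → P n

  ev-map : ∀ {P Q : ℕ → Set} → (∀ n → P n → Q n) → Eventually P → Eventually Q
  ev-map f (N , p) = N , λ n N≤n → f n (p n N≤n)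

  ev-zip : ∀ {P Q R : ℕ → Set} → (∀ n → P n → Q n → R n) →
           Eventually P → Eventually Q → Eventually R
  ev-zip f (M , p) (N , q) = M ℕ.⊔ N , λ n le →
    f n (p n (ℕ.≤-trans (ℕ.m≤m⊔n M N) le)) (q n (ℕ.≤-trans (ℕ.m≤n⊔m M N) le))

IsCauchy : (ℕ → ℚ) → Set
IsCauchy x = ∀ ε → 0ℚ ℚ.< ε →
  ∃ λ N → ∀ m n → N ℕ.≤ m → N ℕ.≤ n → ∣ x m ℚ.- x n ∣ ℚ.≤ ε

record ℝ : Set where
  constructor mkℝ
  field
    seq    : ℕ → ℚ
    cauchy : IsCauchy seq

open ℝ public

infix 4 _≈ᵣ_ _≤ᵣ_

-- Records rather than functions, so that x and y can be inferred.

record _≈ᵣ_ (x y : ℝ) : Set where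
  constructor mk≈
  field
    close : ∀ ε → 0ℚ ℚ.< ε →
      ∃ λ N → ∀ n → N ℕ.≤ n → ∣ seq x n ℚ.- seq y n ∣ ℚ.≤ ε

record _≤ᵣ_ (x y : ℝ) : Set where
  constructor mk≤
  field
    below : ∀ ε → 0ℚ ℚ.< ε →
      ∃ λ N → ∀ n → N ℕ.≤ n → seq x n ℚ.≤ seq y n ℚ.+ ε

private
  open +-*-Solver using (solve; _:+_; _:*_; _:-_; :-_; _:=_; con)

  abstract
    half : ℚ → ℚ
    half ε = ½ ℚ.* ε

    half-pos : ∀ {ε} → 0ℚ ℚ.< ε → 0ℚ ℚ.< half ε
    half-pos {ε} 0<ε = ≡.subst (ℚ._< half ε) (ℚ.*-zeroʳ ½) (ℚ.*-monoʳ-<-pos ½ 0<ε)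

    half+half : ∀ ε → half ε ℚ.+ half ε ≡ ε
    half+half = solve 1 (λ e → con ½ :* e :+ con ½ :* e := e) ≡.refl

    neg-sub : ∀ p q → ℚ.- (p ℚ.- q) ≡ q ℚ.- p
    neg-sub = solve 2 (λ a b → :- (a :- b) := b :- a) ≡.refl

    neg-sub-neg : ∀ p q → p ℚ.- q ≡ ℚ.- q ℚ.- ℚ.- p
    neg-sub-neg = solve 2 (λ a b → a :- b := :- b :- :- a) ≡.refl

    add-sub : ∀ p q → q ℚ.+ (p ℚ.- q) ≡ p
    add-sub = solve 2 (λ a b → b :+ (a :- b) := a) ≡.refl

    sub-add : ∀ p q → p ℚ.+ q ℚ.- p ≡ q
    sub-add = solve 2 (λ b e → b :+ e :- b := e) ≡.refl

    sub-split : ∀ p q r → p ℚ.- r ≡ (p ℚ.- q) ℚ.+ (q ℚ.- r)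
    sub-split = solve 3 (λ a b c → a :- c := (a :- b) :+ (b :- c)) ≡.refl

    add-diff : ∀ p q r s → (p ℚ.+ r) ℚ.- (q ℚ.+ s) ≡ (p ℚ.- q) ℚ.+ (r ℚ.- s)
    add-diff = solve 4 (λ a b c d → (a :+ c) :- (b :+ d) := (a :- b) :+ (c :- d)) ≡.refl

    mul-sub : ∀ p q r → p ℚ.* (q ℚ.- r) ≡ p ℚ.* q ℚ.- p ℚ.* r
    mul-sub = solve 3 (λ a b c → a :* (b :- c) := a :* b :- a :* c) ≡.refl

    mul-diff : ∀ p q r s → p ℚ.* r ℚ.- q ℚ.* s ≡ p ℚ.* (r ℚ.- s) ℚ.+ s ℚ.* (p ℚ.- q)
    mul-diff = solve 4 (λ a b c d → a :* c :- b :* d := a :* (c :- d) :+ d :* (a :- b)) ≡.refl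

    interchange : ∀ p q r → (p ℚ.+ r) ℚ.+ (q ℚ.+ r) ≡ (p ℚ.+ q) ℚ.+ (r ℚ.+ r)
    interchange = solve 3 (λ a b e → (a :+ e) :+ (b :+ e) := (a :+ b) :+ (e :+ e)) ≡.refl

    complement-sum : ∀ p → p ℚ.+ ((1ℚ ℚ.- p) ℚ.+ 0ℚ) ≡ 1ℚ
    complement-sum = solve 1 (λ a → a :+ ((con 1ℚ :- a) :+ con 0ℚ) := con 1ℚ) ≡.refl

    p≤∣p∣ : ∀ p → p ℚ.≤ ∣ p ∣
    p≤∣p∣ p with ℚ.≤-total 0ℚ p
    ... | inj₁ 0≤p = ℚ.≤-reflexive (≡.sym (ℚ.0≤p⇒∣p∣≡p 0≤p))
    ... | inj₂ p≤0 = ℚ.≤-trans p≤0 (ℚ.0≤∣p∣ p)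

    ∣p-q∣≡∣q-p∣ : ∀ p q → ∣ p ℚ.- q ∣ ≡ ∣ q ℚ.- p ∣
    ∣p-q∣≡∣q-p∣ p q = ≡.trans (≡.sym (ℚ.∣-p∣≡∣p∣ (p ℚ.- q)))
      (≡.cong ∣_∣ (neg-sub p q))

    shift : ∀ p q {ε} → p ℚ.- q ℚ.≤ ε → p ℚ.≤ q ℚ.+ ε
    shift p q {ε} h = ≡.subst (ℚ._≤ q ℚ.+ ε)
      (add-sub p q) (ℚ.+-monoʳ-≤ q h)

    unshift : ∀ p q {ε} → p ℚ.≤ q ℚ.+ ε → p ℚ.- q ℚ.≤ ε
    unshift p q {ε} h = ≡.subst (p ℚ.- q ℚ.≤_)
      (sub-add q ε) (ℚ.+-monoˡ-≤ (ℚ.- q) h)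

    ∣-∣-bound : ∀ p {ε} → p ℚ.≤ ε → ℚ.- p ℚ.≤ ε → ∣ p ∣ ℚ.≤ ε
    ∣-∣-bound p h h⁻ with ℚ.∣p∣≡p∨∣p∣≡-p p
    ... | inj₁ e = ≡.subst (ℚ._≤ _) (≡.sym e) h
    ... | inj₂ e = ≡.subst (ℚ._≤ _) (≡.sym e) h⁻

    triangle : ∀ p q {r α β ε} → r ≡ p ℚ.+ q → α ℚ.+ β ≡ ε →
               ∣ p ∣ ℚ.≤ α → ∣ q ∣ ℚ.≤ β → ∣ r ∣ ℚ.≤ ε
    triangle p q ≡.refl ≡.refl h k =
      ℚ.≤-trans (ℚ.∣p+q∣≤∣p∣+∣q∣ p q) (ℚ.+-mono-≤ h k)

    *-mono-≤ : ∀ {p q r s} → 0ℚ ℚ.≤ q → 0ℚ ℚ.≤ r → p ℚ.≤ r → q ℚ.≤ s → p ℚ.* q ℚ.≤ r ℚ.* s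
    *-mono-≤ {p} {q} {r} {s} 0≤q 0≤r p≤r q≤s = ℚ.≤-trans
      (ℚ.*-monoʳ-≤-nonNeg q {{ℚ.nonNegative 0≤q}} p≤r)
      (ℚ.*-monoˡ-≤-nonNeg r {{ℚ.nonNegative 0≤r}} q≤s)

    ∣*∣-bound : ∀ p q {B δ} → ∣ p ∣ ℚ.≤ B → ∣ q ∣ ℚ.≤ δ → ∣ p ℚ.* q ∣ ℚ.≤ B ℚ.* δ
    ∣*∣-bound p q h k = ≡.subst (ℚ._≤ _) (≡.sym (ℚ.∣p*q∣≡∣p∣*∣q∣ p q))
      (*-mono-≤ (ℚ.0≤∣p∣ q) (ℚ.≤-trans (ℚ.0≤∣p∣ p) h) h k)

    scale : ∀ B ε → 0ℚ ℚ.< B → 0ℚ ℚ.< ε → ∃ λ δ → 0ℚ ℚ.< δ × B ℚ.* δ ≡ ε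
    scale B ε 0<B 0<ε = δ , 0<δ , eq
      where
      instance
        B-pos : ℚ.Positive B
        B-pos = ℚ.positive 0<B
        B-nonZero : ℚ.NonZero B
        B-nonZero = ℚ.pos⇒nonZero B
      δ : ℚ
      δ = ℚ.1/ B ℚ.* ε
      0<δ : 0ℚ ℚ.< δ
      0<δ = ≡.subst (ℚ._< δ) (ℚ.*-zeroʳ (ℚ.1/ B))
        (ℚ.*-monoʳ-<-pos (ℚ.1/ B) {{ℚ.1/pos⇒pos B}} 0<ε)
      eq : B ℚ.* δ ≡ ε
      eq = ≡.trans (≡.sym (ℚ.*-assoc B (ℚ.1/ B) ε))
        (≡.trans (≡.cong (ℚ._* ε) (ℚ.*-inverseʳ B)) (ℚ.*-identityˡ ε))

    0<1 : 0ℚ ℚ.< 1ℚ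
    0<1 = ℚ.positive⁻¹ 1ℚ

    bounded : ∀ x → ∃ λ B → 0ℚ ℚ.< B × Eventually (λ n → ∣ seq x n ∣ ℚ.≤ B)
    bounded x with cauchy x 1ℚ 0<1
    ... | N , h = ∣ seq x N ∣ ℚ.+ 1ℚ
                , ℚ.+-mono-≤-< (ℚ.0≤∣p∣ (seq x N)) 0<1
                , N , λ n N≤n → triangle (seq x N) (seq x n ℚ.- seq x N)
                    (≡.sym (add-sub (seq x n) (seq x N)))
                    ≡.refl ℚ.≤-refl (h n N N≤n ℕ.≤-refl)

    const-cauchy : ∀ q → IsCauchy (λ _ → q)
    const-cauchy q ε 0<ε = 0 , λ _ _ _ _ →
      ≡.subst (λ r → ∣ r ∣ ℚ.≤ ε) (≡.sym (ℚ.+-inverseʳ q)) (ℚ.<⇒≤ 0<ε)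

    +-cauchy : ∀ x y → IsCauchy (λ n → seq x n ℚ.+ seq y n)
    +-cauchy x y ε 0<ε with cauchy x (half ε) (half-pos 0<ε) | cauchy y (half ε) (half-pos 0<ε)
    ... | M , h | N , k = M ℕ.⊔ N , λ m n lm ln → triangle (seq x m ℚ.- seq x n) (seq y m ℚ.- seq y n)
      (add-diff (seq x m) (seq x n) (seq y m) (seq y n))
      (half+half ε)
      (h m n (ℕ.≤-trans (ℕ.m≤m⊔n M N) lm) (ℕ.≤-trans (ℕ.m≤m⊔n M N) ln))
      (k m n (ℕ.≤-trans (ℕ.m≤n⊔m M N) lm) (ℕ.≤-trans (ℕ.m≤n⊔m M N) ln))

    neg-cauchy : ∀ x → IsCauchy (λ n → ℚ.- seq x n)
    neg-cauchy x ε 0<ε with cauchy x ε 0<ε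
    ... | N , h = N , λ m n lm ln → ≡.subst (ℚ._≤ ε)
      (≡.cong ∣_∣ (neg-sub-neg (seq x n) (seq x m)))
      (h n m ln lm)

    *-cauchy : ∀ x y → IsCauchy (λ n → seq x n ℚ.* seq y n)
    *-cauchy x y ε 0<ε =
      let B , 0<B , M₁ , b = bounded x
          C , 0<C , M₂ , c = bounded y
          β , 0<β , eβ = scale B (half ε) 0<B (half-pos 0<ε)
          γ , 0<γ , eγ = scale C (half ε) 0<C (half-pos 0<ε)
          N₁ , h = cauchy x γ 0<γ
          N₂ , k = cauchy y β 0<β
          N = (M₁ ℕ.⊔ M₂) ℕ.⊔ (N₁ ℕ.⊔ N₂)
          M₁≤N = ℕ.≤-trans (ℕ.m≤m⊔n M₁ M₂) (ℕ.m≤m⊔n (M₁ ℕ.⊔ M₂) (N₁ ℕ.⊔ N₂))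
          M₂≤N = ℕ.≤-trans (ℕ.m≤n⊔m M₁ M₂) (ℕ.m≤m⊔n (M₁ ℕ.⊔ M₂) (N₁ ℕ.⊔ N₂))
          N₁≤N = ℕ.≤-trans (ℕ.m≤m⊔n N₁ N₂) (ℕ.m≤n⊔m (M₁ ℕ.⊔ M₂) (N₁ ℕ.⊔ N₂))
          N₂≤N = ℕ.≤-trans (ℕ.m≤n⊔m N₁ N₂) (ℕ.m≤n⊔m (M₁ ℕ.⊔ M₂) (N₁ ℕ.⊔ N₂))
      in N , λ m n lm ln → triangle
        (seq x m ℚ.* (seq y m ℚ.- seq y n)) (seq y n ℚ.* (seq x m ℚ.- seq x n))
        (mul-diff (seq x m) (seq x n) (seq y m) (seq y n))
        (half+half ε)
        (≡.subst (∣ seq x m ℚ.* (seq y m ℚ.- seq y n) ∣ ℚ.≤_) eβ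
          (∣*∣-bound (seq x m) (seq y m ℚ.- seq y n) (b m (ℕ.≤-trans M₁≤N lm))
            (k m n (ℕ.≤-trans N₂≤N lm) (ℕ.≤-trans N₂≤N ln))))
        (≡.subst (∣ seq y n ℚ.* (seq x m ℚ.- seq x n) ∣ ℚ.≤_) eγ
          (∣*∣-bound (seq y n) (seq x m ℚ.- seq x n) (c n (ℕ.≤-trans M₂≤N ln))
            (h m n (ℕ.≤-trans N₁≤N lm) (ℕ.≤-trans N₁≤N ln))))

infixl 6 _+ᵣ_ _-ᵣ_
infixl 7 _*ᵣ_
infix  8 -ᵣ_

ofℚ : ℚ → ℝ
ofℚ q = mkℝ (λ _ → q) (const-cauchy q)

0ᵣ 1ᵣ : ℝ
0ᵣ = ofℚ 0ℚ
1ᵣ = ofℚ 1ℚ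

_+ᵣ_ : ℝ → ℝ → ℝ
x +ᵣ y = mkℝ (λ n → seq x n ℚ.+ seq y n) (+-cauchy x y)

_*ᵣ_ : ℝ → ℝ → ℝ
x *ᵣ y = mkℝ (λ n → seq x n ℚ.* seq y n) (*-cauchy x y)

-ᵣ_ : ℝ → ℝ
-ᵣ x = mkℝ (λ n → ℚ.- seq x n) (neg-cauchy x)

_-ᵣ_ : ℝ → ℝ → ℝ
x -ᵣ y = x +ᵣ -ᵣ y

private
  abstract
    pointwise : ∀ x y → (∀ n → seq x n ≡ seq y n) → x ≈ᵣ y
    pointwise x y h = mk≈ λ ε 0<ε → 0 , λ n _ → ≡.subst (λ r → ∣ r ∣ ℚ.≤ ε)
      (≡.sym (≡.trans (≡.cong (ℚ._- seq y n) (h n)) (ℚ.+-inverseʳ (seq y n)))) (ℚ.<⇒≤ 0<ε)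

    ≈-sym : ∀ x y → x ≈ᵣ y → y ≈ᵣ x
    ≈-sym x y (mk≈ h) = mk≈ λ ε 0<ε →
      ev-map (λ n → ≡.subst (ℚ._≤ ε) (∣p-q∣≡∣q-p∣ (seq x n) (seq y n))) (h ε 0<ε)

    ≈-trans : ∀ x y z → x ≈ᵣ y → y ≈ᵣ z → x ≈ᵣ z
    ≈-trans x y z (mk≈ h) (mk≈ k) = mk≈ λ ε 0<ε → ev-zip
      (λ n → triangle (seq x n ℚ.- seq y n) (seq y n ℚ.- seq z n)
        (sub-split (seq x n) (seq y n) (seq z n))
        (half+half ε))
      (h (half ε) (half-pos 0<ε)) (k (half ε) (half-pos 0<ε))

    +-cong : ∀ x y u v → x ≈ᵣ y → u ≈ᵣ v → x +ᵣ u ≈ᵣ y +ᵣ v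
    +-cong x y u v (mk≈ h) (mk≈ k) = mk≈ λ ε 0<ε → ev-zip
      (λ n → triangle (seq x n ℚ.- seq y n) (seq u n ℚ.- seq v n)
        (add-diff (seq x n) (seq y n) (seq u n) (seq v n))
        (half+half ε))
      (h (half ε) (half-pos 0<ε)) (k (half ε) (half-pos 0<ε))

    neg-cong : ∀ x y → x ≈ᵣ y → -ᵣ x ≈ᵣ -ᵣ y
    neg-cong x y (mk≈ h) = mk≈ λ ε 0<ε → ev-map
      (λ n → ≡.subst (ℚ._≤ ε)
        (≡.trans (∣p-q∣≡∣q-p∣ (seq x n) (seq y n))
          (≡.cong ∣_∣ (neg-sub-neg (seq y n) (seq x n)))))
      (h ε 0<ε)

    *-congˡ : ∀ x u v → u ≈ᵣ v → x *ᵣ u ≈ᵣ x *ᵣ v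
    *-congˡ x u v (mk≈ h) = mk≈ λ ε 0<ε →
      let B , 0<B , b = bounded x
          δ , 0<δ , e = scale B ε 0<B 0<ε
      in ev-zip
      (λ n p q → ≡.subst₂ (λ r s → ∣ r ∣ ℚ.≤ s)
        (mul-sub (seq x n) (seq u n) (seq v n))
        e (∣*∣-bound (seq x n) (seq u n ℚ.- seq v n) p q))
      b (h δ 0<δ)

    *-comm : ∀ x y → x *ᵣ y ≈ᵣ y *ᵣ x
    *-comm x y = pointwise (x *ᵣ y) (y *ᵣ x) (λ n → ℚ.*-comm (seq x n) (seq y n))

    *-cong : ∀ x y u v → x ≈ᵣ y → u ≈ᵣ v → x *ᵣ u ≈ᵣ y *ᵣ v
    *-cong x y u v h k = ≈-trans (x *ᵣ u) (x *ᵣ v) (y *ᵣ v) (*-congˡ x u v k)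
      (≈-trans (x *ᵣ v) (v *ᵣ x) (y *ᵣ v) (*-comm x v)
        (≈-trans (v *ᵣ x) (v *ᵣ y) (y *ᵣ v) (*-congˡ v x y h) (*-comm v y)))

    ≤-reflexive : ∀ x y → x ≈ᵣ y → x ≤ᵣ y
    ≤-reflexive x y (mk≈ h) = mk≤ λ ε 0<ε →
      ev-map (λ n p → shift (seq x n) (seq y n) (ℚ.≤-trans (p≤∣p∣ (seq x n ℚ.- seq y n)) p)) (h ε 0<ε)

    ≤-trans : ∀ x y z → x ≤ᵣ y → y ≤ᵣ z → x ≤ᵣ z
    ≤-trans x y z (mk≤ h) (mk≤ k) = mk≤ λ ε 0<ε → ev-zip
      (λ n p q → ≡.subst (seq x n ℚ.≤_)
        (≡.trans (ℚ.+-assoc (seq z n) (half ε) (half ε)) (≡.cong (seq z n ℚ.+_) (half+half ε)))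
        (ℚ.≤-trans p (ℚ.+-monoˡ-≤ (half ε) q)))
      (h (half ε) (half-pos 0<ε)) (k (half ε) (half-pos 0<ε))

    ≤-antisym : ∀ x y → x ≤ᵣ y → y ≤ᵣ x → x ≈ᵣ y
    ≤-antisym x y (mk≤ h) (mk≤ k) = mk≈ λ ε 0<ε → ev-zip
      (λ n p q → ∣-∣-bound (seq x n ℚ.- seq y n) (unshift (seq x n) (seq y n) p) (≡.subst (ℚ._≤ ε)
        (≡.sym (neg-sub (seq x n) (seq y n))) (unshift (seq y n) (seq x n) q)))
      (h ε 0<ε) (k ε 0<ε)

    +-mono : ∀ x y u v → x ≤ᵣ y → u ≤ᵣ v → x +ᵣ u ≤ᵣ y +ᵣ v
    +-mono x y u v (mk≤ h) (mk≤ k) = mk≤ λ ε 0<ε → ev-zip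
      (λ n p q → ≡.subst (seq x n ℚ.+ seq u n ℚ.≤_)
        (≡.trans
          (interchange (seq y n) (seq v n) (half ε))
          (≡.cong (seq y n ℚ.+ seq v n ℚ.+_) (half+half ε)))
        (ℚ.+-mono-≤ p q))
      (h (half ε) (half-pos 0<ε)) (k (half ε) (half-pos 0<ε))

    *-nonNeg : ∀ x y → 0ᵣ ≤ᵣ x → 0ᵣ ≤ᵣ y → 0ᵣ ≤ᵣ x *ᵣ y
    *-nonNeg x y (mk≤ h) (mk≤ k) = mk≤ λ ε 0<ε →
      let B , 0<B , b = bounded x
          C , 0<C , c = bounded y
          β , 0<β , eβ = scale B ε 0<B 0<ε
          γ , 0<γ , eγ = scale C ε 0<C 0<ε
      in ev-zip
        (λ n p q → step (seq x n) (seq y n) 0<ε 0<β 0<γ eβ eγ (proj₁ p) (proj₂ p) (proj₁ q) (proj₂ q))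
        (ev-zip (λ n → _,_) b (h γ 0<γ)) (ev-zip (λ n → _,_) c (k β 0<β))
      where
      small : ∀ p {δ} → p ℚ.≤ 0ℚ → 0ℚ ℚ.≤ p ℚ.+ δ → 0ℚ ℚ.< δ → ∣ p ∣ ℚ.≤ δ
      small p {δ} p≤0 q 0<δ = ∣-∣-bound p (ℚ.≤-trans p≤0 (ℚ.<⇒≤ 0<δ))
        (≡.subst (ℚ._≤ δ) (ℚ.+-identityˡ (ℚ.- p)) (unshift 0ℚ p q))
      nonneg : ∀ p {ε} → ∣ p ∣ ℚ.≤ ε → 0ℚ ℚ.≤ p ℚ.+ ε
      nonneg p {ε} l = shift 0ℚ p (≡.subst (ℚ._≤ ε) (≡.sym (ℚ.+-identityˡ (ℚ.- p)))
        (ℚ.≤-trans (p≤∣p∣ (ℚ.- p)) (≡.subst (ℚ._≤ ε) (≡.sym (ℚ.∣-p∣≡∣p∣ p)) l)))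
      step : ∀ p q {ε B C β γ} → 0ℚ ℚ.< ε → 0ℚ ℚ.< β → 0ℚ ℚ.< γ → B ℚ.* β ≡ ε → C ℚ.* γ ≡ ε →
             ∣ p ∣ ℚ.≤ B → 0ℚ ℚ.≤ p ℚ.+ γ → ∣ q ∣ ℚ.≤ C → 0ℚ ℚ.≤ q ℚ.+ β →
             0ℚ ℚ.≤ p ℚ.* q ℚ.+ ε
      step p q 0<ε 0<β 0<γ eβ eγ b h c k with ℚ.≤-total 0ℚ p | ℚ.≤-total 0ℚ q
      ... | inj₁ 0≤p | inj₁ 0≤q = ℚ.+-mono-≤
        (≡.subst (ℚ._≤ p ℚ.* q) (ℚ.*-zeroˡ 0ℚ) (*-mono-≤ ℚ.≤-refl 0≤p 0≤p 0≤q))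
        (ℚ.<⇒≤ 0<ε)
      ... | inj₂ p≤0 | _ = nonneg (p ℚ.* q) (≡.subst₂ (λ r s → ∣ r ∣ ℚ.≤ s) (ℚ.*-comm q p) eγ
        (∣*∣-bound q p c (small p p≤0 h 0<γ)))
      ... | _ | inj₂ q≤0 = nonneg (p ℚ.* q) (≡.subst (∣ p ℚ.* q ∣ ℚ.≤_) eβ
        (∣*∣-bound p q b (small q q≤0 k 0<β)))

ℝ-commutativeRing : CommutativeRing 0ℓ 0ℓ
ℝ-commutativeRing = record
  { Carrier = ℝ
  ; _≈_ = _≈ᵣ_
  ; _+_ = _+ᵣ_
  ; _*_ = _*ᵣ_
  ; -_  = -ᵣ_
  ; 0#  = 0ᵣ
  ; 1#  = 1ᵣ
  ; isCommutativeRing = record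
    { isRing = record
      { +-isAbelianGroup = record
        { isGroup = record
          { isMonoid = record
            { isSemigroup = record
              { isMagma = record
                { isEquivalence = record
                  { refl  = λ {x} → pointwise x x (λ _ → ≡.refl)
                  ; sym   = λ {x} {y} → ≈-sym x y
                  ; trans = λ {x} {y} {z} → ≈-trans x y z
                  }
                ; ∙-cong = λ {x} {y} {u} {v} → +-cong x y u v
                }
              ; assoc = λ x y z → pointwise ((x +ᵣ y) +ᵣ z) (x +ᵣ (y +ᵣ z))
                  (λ n → ℚ.+-assoc (seq x n) (seq y n) (seq z n))
              }
            ; identity = (λ x → pointwise (0ᵣ +ᵣ x) x (λ n → ℚ.+-identityˡ (seq x n)))
                       , (λ x → pointwise (x +ᵣ 0ᵣ) x (λ n → ℚ.+-identityʳ (seq x n)))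
            }
          ; inverse = (λ x → pointwise (-ᵣ x +ᵣ x) 0ᵣ (λ n → ℚ.+-inverseˡ (seq x n)))
                    , (λ x → pointwise (x +ᵣ -ᵣ x) 0ᵣ (λ n → ℚ.+-inverseʳ (seq x n)))
          ; ⁻¹-cong = λ {x} {y} → neg-cong x y
          }
        ; comm = λ x y → pointwise (x +ᵣ y) (y +ᵣ x) (λ n → ℚ.+-comm (seq x n) (seq y n))
        }
      ; *-cong = λ {x} {y} {u} {v} → *-cong x y u v
      ; *-assoc = λ x y z → pointwise ((x *ᵣ y) *ᵣ z) (x *ᵣ (y *ᵣ z))
          (λ n → ℚ.*-assoc (seq x n) (seq y n) (seq z n))
      ; *-identity = (λ x → pointwise (1ᵣ *ᵣ x) x (λ n → ℚ.*-identityˡ (seq x n)))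
                   , (λ x → pointwise (x *ᵣ 1ᵣ) x (λ n → ℚ.*-identityʳ (seq x n)))
      ; distrib = (λ x y z → pointwise (x *ᵣ (y +ᵣ z)) (x *ᵣ y +ᵣ x *ᵣ z)
                    (λ n → ℚ.*-distribˡ-+ (seq x n) (seq y n) (seq z n)))
                , (λ x y z → pointwise ((y +ᵣ z) *ᵣ x) (y *ᵣ x +ᵣ z *ᵣ x)
                    (λ n → ℚ.*-distribʳ-+ (seq x n) (seq y n) (seq z n)))
      }
    ; *-comm = *-comm
    }
  }

ℝ-poset : Poset 0ℓ 0ℓ 0ℓ
ℝ-poset = record
  { Carrier = ℝ
  ; _≈_ = _≈ᵣ_
  ; _≤_ = _≤ᵣ_
  ; isPartialOrder = record
    { isPreorder = record
      { isEquivalence = CommutativeRing.isEquivalence ℝ-commutativeRing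
      ; reflexive = λ {x} {y} → ≤-reflexive x y
      ; trans = λ {x} {y} {z} → ≤-trans x y z
      }
    ; antisym = λ {x} {y} → ≤-antisym x y
    }
  }

private
  module ℝ-ring = CommutativeRing ℝ-commutativeRing
  module ℝ-order = Poset ℝ-poset

open SemiringSum ℝ-ring.semiring public using (sum; sum-syntax)

private
  open SemiringSum ℝ-ring.semiring
    using (sum-cong-≋; sum-replicate-zero; ∑-comm; *-distribˡ-sum)

record 𝕀 : Set where
  constructor mk𝕀
  field
    value : ℝ
    0≤    : 0ᵣ ≤ᵣ value
    ≤1    : value ≤ᵣ 1ᵣ

open 𝕀 public

𝕀-poset : Poset 0ℓ 0ℓ 0ℓ
𝕀-poset = On.poset ℝ-poset value

record Weights (m : ℕ) : Set where
  constructor mkWeights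
  field
    weight  : Vector ℝ m
    0≤w     : ∀ i → 0ᵣ ≤ᵣ weight i
    sum≈1   : sum weight ≈ᵣ 1ᵣ

open Weights public

kronecker : ∀ {m} → Fin m → Fin m → ℝ
kronecker i j = if does (i Fin.≟ j) then 1ᵣ else 0ᵣ

private
  0≤1 : 0ᵣ ≤ᵣ 1ᵣ
  0≤1 = mk≤ λ ε 0<ε → 0 , λ _ _ → ℚ.+-mono-≤ (ℚ.<⇒≤ 0<1) (ℚ.<⇒≤ 0<ε)

  kronecker-nonNeg : ∀ {m} (i j : Fin m) → 0ᵣ ≤ᵣ kronecker i j
  kronecker-nonNeg i j with does (i Fin.≟ j)
  ... | true  = 0≤1
  ... | false = ℝ-order.refl

  kronecker-sum : ∀ {m} (i : Fin m) → sum (kronecker i) ≈ᵣ 1ᵣ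
  kronecker-sum {ℕ.suc m} zero =
    ℝ-ring.trans (ℝ-ring.+-congˡ {1ᵣ} (sum-replicate-zero m)) (ℝ-ring.+-identityʳ 1ᵣ)
  kronecker-sum {ℕ.suc m} (suc i) =
    ℝ-ring.trans (ℝ-ring.+-identityˡ (sum (kronecker i))) (kronecker-sum i)

  +-nonNeg : ∀ x y → 0ᵣ ≤ᵣ x → 0ᵣ ≤ᵣ y → 0ᵣ ≤ᵣ x +ᵣ y
  +-nonNeg x y h k = ℝ-order.trans {0ᵣ} {0ᵣ +ᵣ 0ᵣ} {x +ᵣ y}
    (ℝ-order.reflexive {0ᵣ} {0ᵣ +ᵣ 0ᵣ} (ℝ-ring.sym (ℝ-ring.+-identityˡ 0ᵣ)))
    (+-mono 0ᵣ x 0ᵣ y h k)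

  sum-nonNeg : ∀ {m} (x : Vector ℝ m) → (∀ i → 0ᵣ ≤ᵣ x i) → 0ᵣ ≤ᵣ sum x
  sum-nonNeg {ℕ.zero}  x h = ℝ-order.refl {0ᵣ}
  sum-nonNeg {ℕ.suc m} x h =
    +-nonNeg (x zero) (sum (x ∘ suc)) (h zero) (sum-nonNeg (x ∘ suc) (h ∘ suc))

  sub-nonNeg : ∀ x y → x ≤ᵣ y → 0ᵣ ≤ᵣ y -ᵣ x
  sub-nonNeg x y h = ℝ-order.trans {0ᵣ} {x -ᵣ x} {y -ᵣ x}
    (ℝ-order.reflexive {0ᵣ} {x -ᵣ x} (ℝ-ring.sym (ℝ-ring.-‿inverseʳ x)))
    (+-mono x y (-ᵣ x) (-ᵣ x) h (ℝ-order.refl { -ᵣ x}))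

δ : ∀ {m} → Fin m → Weights m
δ i = mkWeights (kronecker i) (kronecker-nonNeg i) (kronecker-sum i)

-- The product of the row vector r with the row-stochastic matrix s.
infixl 7 _⊙_

_⊙_ : ∀ {m n} → Weights m → (Fin m → Weights n) → Weights n
_⊙_ {m} {n} r s = mkWeights
  (λ j → ∑[ i < m ] (weight r i *ᵣ weight (s i) j))
  (λ j → sum-nonNeg (λ i → weight r i *ᵣ weight (s i) j)
    (λ i → *-nonNeg (weight r i) (weight (s i) j) (0≤w r i) (0≤w (s i) j)))
  (begin
    ∑[ j < n ] ∑[ i < m ] (weight r i *ᵣ weight (s i) j)
      ≈⟨ ∑-comm (λ i j → weight r i *ᵣ weight (s i) j) ⟨
    ∑[ i < m ] ∑[ j < n ] (weight r i *ᵣ weight (s i) j)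
      ≈⟨ sum-cong-≋ (λ i → ℝ-ring.trans
           (ℝ-ring.sym (*-distribˡ-sum (weight r i) (weight (s i))))
           (ℝ-ring.trans (ℝ-ring.*-congˡ {weight r i} (sum≈1 (s i)))
             (ℝ-ring.*-identityʳ (weight r i)))) ⟩
    sum (weight r)
      ≈⟨ sum≈1 r ⟩
    1ᵣ ∎)
  where open import Relation.Binary.Reasoning.Setoid ℝ-ring.setoid

binary : 𝕀 → Weights 2
binary l = mkWeights (value l ∷ (1ᵣ -ᵣ value l) ∷ [])
  (λ { zero → 0≤ l ; (suc zero) → sub-nonNeg (value l) 1ᵣ (≤1 l) })
  (pointwise (value l +ᵣ ((1ᵣ -ᵣ value l) +ᵣ 0ᵣ)) 1ᵣ
    (λ n → complement-sum (seq (value l) n)))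

record ConvexStructure {a ℓ} (S : Setoid a ℓ) : Set (a ⊔ ℓ) where
  open Setoid S
  field
    ⨁ : ∀ {m} → Weights m → Vector Carrier m → Carrier

    -- Well-definedness: real numbers and elements are only given up to
    -- setoid equality.
    ⨁-cong : ∀ {m} {r s : Weights m} {x y : Vector Carrier m} →
             (∀ i → weight r i ≈ᵣ weight s i) → (∀ i → x i ≈ y i) →
             ⨁ r x ≈ ⨁ s y

    ⨁-δ : ∀ {m} (i : Fin m) (x : Vector Carrier m) → ⨁ (δ i) x ≈ x i

    ⨁-⨁ : ∀ {m n} (r : Weights m) (s : Fin m → Weights n) (x : Vector Carrier n) →
          ⨁ r (λ i → ⨁ (s i) x) ≈ ⨁ (r ⊙ s) x

  _⊕[_]_ : Carrier → 𝕀 → Carrier → Carrier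
  x ⊕[ l ] y = ⨁ (binary l) (x ∷ y ∷ [])

-- Directed subsets are given as families indexed by types in Set ι; under
-- excluded middle, for a poset at level ι this covers all directed subsets.

module _ {c ℓ₁ ℓ₂} (P : Poset c ℓ₁ ℓ₂) where
  open Poset P

  record IsDirected {ι} {I : Set ι} (s : I → Carrier) : Set (ι ⊔ ℓ₂) where
    field
      inhabitant : I
      semidirected : ∀ i j → ∃ λ k → s i ≤ s k × s j ≤ s k

  record IsLub {ι} {I : Set ι} (s : I → Carrier) (x : Carrier) : Set (ι ⊔ c ⊔ ℓ₂) where
    field
      upper : ∀ i → s i ≤ x
      least : ∀ y → (∀ i → s i ≤ y) → x ≤ y

  IsDcpo : ∀ ι → Set (lsuc ι ⊔ c ⊔ ℓ₂)
  IsDcpo ι = ∀ {I : Set ι} (s : I → Carrier) → IsDirected s → ∃ (IsLub s)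

infix 8 _^_

_^_ : ∀ {c ℓ₁ ℓ₂} → Poset c ℓ₁ ℓ₂ → ℕ → Poset c ℓ₁ ℓ₂
P ^ m = record
  { Carrier = Vector Carrier m
  ; _≈_ = Pointwise _≈_
  ; _≤_ = Pointwise _≤_
  ; isPartialOrder = record
    { isPreorder = record
      { isEquivalence = Pointwise.isEquivalence isEquivalence m
      ; reflexive = λ x≈y i → reflexive (x≈y i)
      ; trans = λ x≤y y≤z i → trans (x≤y i) (y≤z i)
      }
    ; antisym = λ x≤y y≤x i → antisym (x≤y i) (y≤x i)
    }
  }
  where open Poset P

record IsScottContinuous {c₁ ℓ₁₁ ℓ₁₂ c₂ ℓ₂₁ ℓ₂₂} (ι : Level)
  (P : Poset c₁ ℓ₁₁ ℓ₁₂) (Q : Poset c₂ ℓ₂₁ ℓ₂₂)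
  (f : Poset.Carrier P → Poset.Carrier Q) :
  Set (lsuc ι ⊔ c₁ ⊔ ℓ₁₁ ⊔ ℓ₁₂ ⊔ c₂ ⊔ ℓ₂₁ ⊔ ℓ₂₂) where
  private
    module P = Poset P
    module Q = Poset Q
  field
    isOrderHomomorphism : IsOrderHomomorphism P._≈_ Q._≈_ P._≤_ Q._≤_ f
    preservesLub : ∀ {I : Set ι} (s : I → P.Carrier) → IsDirected P s →
                   ∀ x → IsLub P s x → IsLub Q (f ∘ s) (f x)

  open IsOrderHomomorphism isOrderHomomorphism public using (cong; mono)

record ConvexDcpo (ℓ : Level) : Set (lsuc ℓ) where
  field
    poset  : Poset ℓ ℓ ℓ
    isDcpo : IsDcpo poset ℓ

  open Poset poset public

  field
    convex : ConvexStructure Eq.setoid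

  open ConvexStructure convex public

  field
    ⨁-continuous : ∀ {m} (r : Weights m) → IsScottContinuous ℓ (poset ^ m) poset (⨁ r)

record PointedConvexDcpo (ℓ : Level) : Set (lsuc ℓ) where
  field
    convexDcpo : ConvexDcpo ℓ

  open ConvexDcpo convexDcpo public

  field
    ⊥       : Carrier
    minimum : Minimum _≤_ ⊥

  infixr 7 _·_

  _·_ : 𝕀 → Carrier → Carrier
  l · x = x ⊕[ l ] ⊥

record Kegelspitze (ℓ : Level) : Set (lsuc ℓ) where
  field
    pointedConvexDcpo : PointedConvexDcpo ℓ

  open PointedConvexDcpo pointedConvexDcpo public

  field
    ·-continuousˡ : ∀ x → IsScottContinuous ℓ 𝕀-poset poset (_· x)
    ·-continuousʳ : ∀ l → IsScottContinuous ℓ poset poset (l ·_)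

record Category (o h e : Level) : Set (lsuc (o ⊔ h ⊔ e)) where
  infix  4 _≈_
  infixr 9 _⊚_
  field
    Obj : Set o
    Hom : Obj → Obj → Set h
    _≈_ : ∀ {A B} → Hom A B → Hom A B → Set e
    ident : ∀ {A} → Hom A A
    _⊚_ : ∀ {A B C} → Hom B C → Hom A B → Hom A C
    isEquivalence : ∀ {A B} → IsEquivalence (_≈_ {A} {B})
    ⊚-cong : ∀ {A B C} {f g : Hom B C} {h k : Hom A B} →
             f ≈ g → h ≈ k → f ⊚ h ≈ g ⊚ k
    identityˡ : ∀ {A B} (f : Hom A B) → ident ⊚ f ≈ f
    identityʳ : ∀ {A B} (f : Hom A B) → f ⊚ ident ≈ f
    assoc : ∀ {A B C D} (f : Hom C D) (g : Hom B C) (h : Hom A B) →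
            (f ⊚ g) ⊚ h ≈ f ⊚ (g ⊚ h)

module _ {o h e} (𝒞 : Category o h e) where
  open Category 𝒞

  record Terminal : Set (o ⊔ h ⊔ e) where
    field
      ⊤ : Obj
      ! : ∀ {A} → Hom A ⊤
      !-unique : ∀ {A} (f : Hom A ⊤) → f ≈ !

  record Product (A B : Obj) : Set (o ⊔ h ⊔ e) where
    field
      A×B : Obj
      π₁ : Hom A×B A
      π₂ : Hom A×B B
      ⟨_,_⟩ : ∀ {C} → Hom C A → Hom C B → Hom C A×B
      project₁ : ∀ {C} (f : Hom C A) (g : Hom C B) → π₁ ⊚ ⟨ f , g ⟩ ≈ f
      project₂ : ∀ {C} (f : Hom C A) (g : Hom C B) → π₂ ⊚ ⟨ f , g ⟩ ≈ g
      unique : ∀ {C} (f : Hom C A) (g : Hom C B) (k : Hom C A×B) →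
               π₁ ⊚ k ≈ f → π₂ ⊚ k ≈ g → k ≈ ⟨ f , g ⟩

  module _ (product : ∀ A B → Product A B) where
    private
      module ⊗ {A B} = Product (product A B)

      _⊗_ : Obj → Obj → Obj
      A ⊗ B = Product.A×B (product A B)

      _⊗id : ∀ {A B C} → Hom A B → Hom (A ⊗ C) (B ⊗ C)
      f ⊗id = ⊗.⟨ f ⊚ ⊗.π₁ , ⊗.π₂ ⟩

    record Exponential (A B : Obj) : Set (o ⊔ h ⊔ e) where
      field
        B^A : Obj
        eval : Hom (B^A ⊗ A) B
        curry : ∀ {C} → Hom (C ⊗ A) B → Hom C B^A
        β : ∀ {C} (f : Hom (C ⊗ A) B) → eval ⊚ (curry f ⊗id) ≈ f
        unique : ∀ {C} (f : Hom (C ⊗ A) B) (k : Hom C B^A) →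
                 eval ⊚ (k ⊗id) ≈ f → k ≈ curry f

  record CartesianClosed : Set (o ⊔ h ⊔ e) where
    field
      terminal : Terminal
      product : ∀ A B → Product A B
      exponential : ∀ A B → Exponential product A B

-- IsScottContinuous quantifies over Set ℓ, so Scott-continuous maps form a
-- type in Set (lsuc ℓ), whereas the carrier of a Kegelspitze is in Set ℓ. For
-- function spaces to be objects the continuity predicate has to be resized,
-- which excluded middle at level lsuc ℓ allows.
record ScottMap {ℓ} (X Y : Kegelspitze ℓ) : Set (lsuc ℓ) where
  private
    module X = Kegelspitze X
    module Y = Kegelspitze Y
  field
    fun : X.Carrier → Y.Carrier
    continuous : IsScottContinuous ℓ X.poset Y.poset fun

  open IsScottContinuous continuous public

private
  id-continuous : ∀ {ℓ c ℓ₁ ℓ₂} (P : Poset c ℓ₁ ℓ₂) → IsScottContinuous ℓ P P id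
  id-continuous P = record
    { isOrderHomomorphism = record { cong = id ; mono = id }
    ; preservesLub = λ _ _ _ lub → lub
    }

  ∘-scott : ∀ {ℓ} {X Y Z : Kegelspitze ℓ} → ScottMap Y Z → ScottMap X Y → ScottMap X Z
  ∘-scott g f = record
    { fun = g.fun ∘ f.fun
    ; continuous = record
      { isOrderHomomorphism = record { cong = g.cong ∘ f.cong ; mono = g.mono ∘ f.mono }
      ; preservesLub = λ s dir x lub → g.preservesLub (f.fun ∘ s)
          (record
            { inhabitant = IsDirected.inhabitant dir
            ; semidirected = λ i j → let k , i≤k , j≤k = IsDirected.semidirected dir i j
                                     in k , f.mono i≤k , f.mono j≤k
            })
          (f.fun x) (f.preservesLub s dir x lub)
      }
    }
    where
    module g = ScottMap g
    module f = ScottMap f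

open ScottMap using (fun)

KS-Scott : ∀ ℓ → Category (lsuc ℓ) (lsuc ℓ) ℓ
KS-Scott ℓ = record
  { Obj = Kegelspitze ℓ
  ; Hom = ScottMap
  ; _≈_ = λ {X} {Y} f g → ∀ x → Kegelspitze._≈_ Y (fun f x) (fun g x)
  ; ident = λ {X} → record { fun = id ; continuous = id-continuous (Kegelspitze.poset X) }
  ; _⊚_ = ∘-scott
  ; isEquivalence = λ {X} {Y} → record
    { refl  = λ x → Kegelspitze.Eq.refl Y
    ; sym   = λ p x → Kegelspitze.Eq.sym Y (p x)
    ; trans = λ p q x → Kegelspitze.Eq.trans Y (p x) (q x)
    }
  ; ⊚-cong = λ {X} {Y} {Z} {f} {g} {h} {k} f≈g h≈k x →
      Kegelspitze.Eq.trans Z (ScottMap.cong f (h≈k x)) (f≈g (fun k x))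
  ; identityˡ = λ {X} {Y} f x → Kegelspitze.Eq.refl Y
  ; identityʳ = λ {X} {Y} f x → Kegelspitze.Eq.refl Y
  ; assoc = λ {A} {B} {C} {D} f g h x → Kegelspitze.Eq.refl D
  }

{-# OPTIONS --safe #-}

-- Terminal object, products and function spaces all carry a family of maps
-- into Kegelspitzen (the empty family, the two projections, the evaluations at
-- points) that is jointly order-reflecting. Suprema, convex combinations and
-- the least element are computed componentwise, so the Kegelspitze axioms as
-- well as the continuity of maps into these objects can be checked after
-- composition with the members of the family. Since evaluation is Scott-
-- continuous in each argument, it is jointly continuous by directedness.
-- Affinity of the maps plays no role.

module Submission where

open import Defs
open import Level using (Level; Lift; lift; lower; suc)
open import Axiom.ExcludedMiddle using (ExcludedMiddle)
open import Data.Bool.Base using (Bool; true; false; if_then_else_)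
open import Data.Empty using () renaming (⊥ to Empty)
open import Data.Fin.Base as Fin using (Fin)
open import Data.Fin.Properties using (_≟_)
open import Data.Product.Base using (∃; _×_; _,_; proj₁; proj₂)
open import Data.Product.Relation.Binary.Pointwise.NonDependent using (×-poset)
open import Data.Unit.Polymorphic.Properties using (≡-poset)
open import Data.Vec.Functional using (Vector; []; _∷_; updateAt)
open import Data.Vec.Functional.Properties using (updateAt-updates; updateAt-minimal)
open import Function.Base using (id; _∘_; const)
open import Relation.Binary.Bundles using (Poset)
open import Relation.Binary.Consequences using (mono⇒cong)
open import Relation.Binary.Definitions using (Monotonic₁)
import Relation.Binary.PropositionalEquality.Core as ≡
open import Relation.Nullary.Decidable.Core using (yes; no; True; toWitness; fromWitness)

private variable
  c c₁ c₂ c₃ ℓ₁ ℓ₂ ℓ₁₁ ℓ₁₂ ℓ₂₁ ℓ₂₂ ℓ₃₁ ℓ₃₂ ι κ ℓ : Level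

-- Scott continuity of basic maps between posets.

module _ (P : Poset c₁ ℓ₁₁ ℓ₁₂) (Q : Poset c₂ ℓ₂₁ ℓ₂₂) where
  private
    module P = Poset P
    module Q = Poset Q

  mono⇒directed : ∀ {f : P.Carrier → Q.Carrier} → Monotonic₁ P._≤_ Q._≤_ f →
                  ∀ {I : Set ι} {s : I → P.Carrier} → IsDirected P s → IsDirected Q (f ∘ s)
  mono⇒directed f-mono dir = record
    { inhabitant = inhabitant
    ; semidirected = λ i j → let k , i≤k , j≤k = semidirected i j
                             in k , f-mono i≤k , f-mono j≤k
    }
    where open IsDirected dir

  -- Antisymmetry turns monotonicity into compatibility with `_≈_`, so only the order has to be
  -- checked.
  mono∧lub⇒continuous : ∀ {f : P.Carrier → Q.Carrier} → Monotonic₁ P._≤_ Q._≤_ f →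
    (∀ {I : Set ι} (s : I → P.Carrier) → IsDirected P s →
     ∀ x → IsLub P s x → IsLub Q (f ∘ s) (f x)) →
    IsScottContinuous ι P Q f
  mono∧lub⇒continuous f-mono f-lub = record
    { isOrderHomomorphism = record
      { cong = mono⇒cong P._≈_ Q._≈_ P.Eq.sym P.reflexive Q.antisym f-mono
      ; mono = f-mono
      }
    ; preservesLub = f-lub
    }

  -- Equations such as `e-⨁` below hold only up to setoid equality, so continuity has to be carried
  -- across pointwise `_≈_`.
  continuous-resp-≈ : ∀ {f g : P.Carrier → Q.Carrier} → (∀ x → f x Q.≈ g x) →
                      IsScottContinuous ι P Q f → IsScottContinuous ι P Q g
  continuous-resp-≈ f≈g f-cts = mono∧lub⇒continuous
    (λ x≤y → Q.trans (g≤f _) (Q.trans (mono x≤y) (f≤g _)))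
    (λ s dir x lub → let open IsLub (preservesLub s dir x lub) in record
      { upper = λ i → Q.trans (g≤f (s i)) (Q.trans (upper i) (f≤g x))
      ; least = λ y b → Q.trans (g≤f x) (least y (λ i → Q.trans (f≤g (s i)) (b i)))
      })
    where
    open IsScottContinuous f-cts
    f≤g = λ x → Q.reflexive (f≈g x)
    g≤f = λ x → Q.reflexive (Q.Eq.sym (f≈g x))

  const-continuous : ∀ y → IsScottContinuous ι P Q (const y)
  const-continuous y = mono∧lub⇒continuous (λ _ → Q.refl) λ s dir x lub → record
    { upper = λ _ → Q.refl
    -- A directed family is inhabited, so `b` can be applied to some index.
    ; least = λ z b → b (IsDirected.inhabitant dir)
    }

  proj₁-continuous : IsScottContinuous ι (×-poset P Q) P proj₁
  proj₁-continuous = record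
    { isOrderHomomorphism = record { cong = proj₁ ; mono = proj₁ }
    ; preservesLub = λ s dir (x , y) lub → record
      { upper = λ i → proj₁ (IsLub.upper lub i)
      -- Since `y` already bounds the second components, `(z , y)` bounds all of `s`.
      ; least = λ z b → proj₁ (IsLub.least lub (z , y) λ i → b i , proj₂ (IsLub.upper lub i))
      }
    }

  proj₂-continuous : IsScottContinuous ι (×-poset P Q) Q proj₂
  proj₂-continuous = record
    { isOrderHomomorphism = record { cong = proj₂ ; mono = proj₂ }
    ; preservesLub = λ s dir (x , y) lub → record
      { upper = λ i → proj₂ (IsLub.upper lub i)
      ; least = λ z b → proj₂ (IsLub.least lub (x , z) λ i → proj₁ (IsLub.upper lub i) , b i)
      }
    }

module _ (P : Poset c ℓ₁ ℓ₂) where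
  open Poset P

  id-continuous : IsScottContinuous ι P P id
  id-continuous = mono∧lub⇒continuous P P id λ _ _ _ lub → lub

  -- A bound `y` of the `k`-th coordinates extends to a bound of the whole family by putting it in
  -- place of `x k` in the least upper bound `x`.
  lookup-continuous : ∀ {m} (k : Fin m) → IsScottContinuous ι (P ^ m) P (λ x → x k)
  lookup-continuous {m = m} k = mono∧lub⇒continuous (P ^ m) P (λ x≤y → x≤y k)
    λ s dir x lub → let open IsLub lub in record
    { upper = λ i → upper i k
    ; least = λ y b → ≡.subst (x k ≤_) (updateAt-updates k x)
        (least (updateAt x k (const y)) (λ i → ≤-updateAt (s i) x y (upper i) (b i)) k)
    }
    where
    ≤-updateAt : ∀ (z x : Vector Carrier m) y → (∀ j → z j ≤ x j) → z k ≤ y →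
                 ∀ j → z j ≤ updateAt x k (const y) j
    ≤-updateAt z x y z≤x zk≤y j with j ≟ k
    ... | yes ≡.refl = ≡.subst (z k ≤_) (≡.sym (updateAt-updates k x)) zk≤y
    ... | no j≢k = ≡.subst (z j ≤_) (≡.sym (updateAt-minimal j k x j≢k)) (z≤x j)

∘-continuous : ∀ (P : Poset c₁ ℓ₁₁ ℓ₁₂) (Q : Poset c₂ ℓ₂₁ ℓ₂₂) (R : Poset c₃ ℓ₃₁ ℓ₃₂) {f g} →
               IsScottContinuous ι Q R g → IsScottContinuous ι P Q f →
               IsScottContinuous ι P R (g ∘ f)
∘-continuous P Q R g-cts f-cts = mono∧lub⇒continuous P R (λ x≤y → g.mono (f.mono x≤y))
  λ s dir x lub → g.preservesLub _ (mono⇒directed P Q f.mono dir) _ (f.preservesLub s dir x lub)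
  where
  module g = IsScottContinuous g-cts
  module f = IsScottContinuous f-cts

-- Families of maps that jointly reflect the order.

module _ (P : Poset c₁ ℓ₁₁ ℓ₁₂) {K : Set κ} (Q : K → Poset c₂ ℓ₂₁ ℓ₂₂) where
  private
    module P = Poset P
    module Q k = Poset (Q k)

  JointlyReflects : (∀ k → P.Carrier → Q.Carrier k) → Set _
  JointlyReflects e = ∀ {x y} → (∀ k → Q._≤_ k (e k x) (e k y)) → x P.≤ y

  -- By monotonicity each `e k` carries upper bounds in `P` to upper bounds in `Q k`, where
  -- `e k ∘ f` preserves the supremum; the resulting inequalities are reflected back to `P`.
  reflects⇒continuous : ∀ (R : Poset c₃ ℓ₃₁ ℓ₃₂) {e} →
    (∀ k → Monotonic₁ P._≤_ (Q._≤_ k) (e k)) → JointlyReflects e →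
    ∀ {f} → (∀ k → IsScottContinuous ι R (Q k) (e k ∘ f)) → IsScottContinuous ι R P f
  reflects⇒continuous R e-mono e-reflects ef-cts = mono∧lub⇒continuous R P
    (λ x≤y → e-reflects λ k → IsScottContinuous.mono (ef-cts k) x≤y)
    λ s dir x lub →
      let ef-lub = λ k → IsScottContinuous.preservesLub (ef-cts k) s dir x lub in record
      { upper = λ i → e-reflects λ k → IsLub.upper (ef-lub k) i
      ; least = λ y b → e-reflects λ k → IsLub.least (ef-lub k) _ (λ i → e-mono k (b i))
      }

map-continuous : ∀ (P : Poset c₁ ℓ₁₁ ℓ₁₂) (Q : Poset c₂ ℓ₂₁ ℓ₂₂) {f} m →
                 IsScottContinuous ι P Q f → IsScottContinuous ι (P ^ m) (Q ^ m) (f ∘_)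
map-continuous P Q m f-cts = reflects⇒continuous (Q ^ m) (const Q) (P ^ m) {e = λ k x → x k}
  (λ k x≤y → x≤y k) id
  (λ k → ∘-continuous (P ^ m) P Q f-cts (lookup-continuous P k))

-- Kegelspitzen induced by a jointly reflecting family.

module _ {P : Poset ℓ ℓ ℓ} (isDcpo : IsDcpo P ℓ) {K : Set κ} (X : K → Kegelspitze ℓ) where
  private
    module P = Poset P
    module X k = Kegelspitze (X k)

  module _ {e : ∀ k → P.Carrier → X.Carrier k}
           (e-continuous : ∀ k → IsScottContinuous ℓ P (X.poset k) (e k))
           (e-reflects : JointlyReflects P X.poset e)
           (⨁ : ∀ {m} → Weights m → Vector P.Carrier m → P.Carrier)
           (e-⨁ : ∀ k {m} (r : Weights m) x → X._≈_ k (e k (⨁ r x)) (X.⨁ k r (e k ∘ x)))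
           (⊥ : P.Carrier)
           (e-⊥ : ∀ k → X._≈_ k (e k ⊥) (X.⊥ k))
           where
    private
      module e k = IsScottContinuous (e-continuous k)

      reflects-≈ : ∀ {x y} → (∀ k → X._≈_ k (e k x) (e k y)) → x P.≈ y
      reflects-≈ ex≈ey = P.antisym
        (e-reflects λ k → X.reflexive k (ex≈ey k))
        (e-reflects λ k → X.reflexive k (X.Eq.sym k (ex≈ey k)))

      -- `e-⨁` moves each `e k` inside the combinations, where the law already holds in `X k`.
      convex : ConvexStructure P.Eq.setoid
      convex = record
        { ⨁ = ⨁
        ; ⨁-cong = λ {_} {r} {s} {x} {y} r≈s x≈y → reflects-≈ λ k → X.Eq.trans k (e-⨁ k r x)
            (X.Eq.trans k (X.⨁-cong k r≈s (λ i → e.cong k (x≈y i))) (X.Eq.sym k (e-⨁ k s y)))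
        ; ⨁-δ = λ i x → reflects-≈ λ k → X.Eq.trans k (e-⨁ k (δ i) x) (X.⨁-δ k i (e k ∘ x))
        ; ⨁-⨁ = λ r s x → reflects-≈ λ k → X.Eq.trans k (e-⨁ k r (λ i → ⨁ (s i) x))
            (X.Eq.trans k (X.⨁-cong k (λ _ → Poset.Eq.refl ℝ-poset) (λ i → e-⨁ k (s i) x))
              (X.Eq.trans k (X.⨁-⨁ k r s (e k ∘ x)) (X.Eq.sym k (e-⨁ k (r ⊙ s) x))))
        }

      e-· : ∀ k l x → X._≈_ k (X._·_ k l (e k x)) (e k (⨁ (binary l) (x ∷ ⊥ ∷ [])))
      e-· k l x = X.Eq.sym k (X.Eq.trans k (e-⨁ k (binary l) (x ∷ ⊥ ∷ []))
        (X.⨁-cong k (λ _ → Poset.Eq.refl ℝ-poset)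
          (λ { Fin.zero → X.Eq.refl k ; (Fin.suc Fin.zero) → e-⊥ k })))

      continuous : ∀ {c ℓ₁ ℓ₂} (R : Poset c ℓ₁ ℓ₂) {f} →
                   (∀ k → IsScottContinuous ℓ R (X.poset k) (e k ∘ f)) →
                   IsScottContinuous ℓ R P f
      continuous R = reflects⇒continuous P X.poset R e.mono e-reflects

    -- Reflection only yields inequalities, so the existence of directed suprema is an input
    -- (`isDcpo`); the remaining axioms are reflected from the `X k`.
    reflectedKegelspitze : Kegelspitze ℓ
    reflectedKegelspitze = record
      { pointedConvexDcpo = record
        { convexDcpo = record
          { poset = P
          ; isDcpo = isDcpo
          ; convex = convex
          ; ⨁-continuous = λ {m} r → continuous (P ^ m) λ k →
              -- `e k ∘ ⨁ r` agrees with applying `e k` in every coordinate and then combining in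
              -- `X k`, a composite of continuous maps.
              continuous-resp-≈ (P ^ m) (X.poset k) (λ x → X.Eq.sym k (e-⨁ k r x))
                (∘-continuous (P ^ m) (X.poset k ^ m) (X.poset k)
                  (X.⨁-continuous k r) (map-continuous P (X.poset k) m (e-continuous k)))
          }
        ; ⊥ = ⊥
        ; minimum = λ x → e-reflects λ k →
            X.trans k (X.reflexive k (e-⊥ k)) (X.minimum k (e k x))
        }
      ; ·-continuousˡ = λ x → continuous 𝕀-poset λ k →
          continuous-resp-≈ 𝕀-poset (X.poset k) (λ l → e-· k l x) (X.·-continuousˡ k (e k x))
      ; ·-continuousʳ = λ l → continuous P λ k →
          continuous-resp-≈ P (X.poset k) (e-· k l)
            (∘-continuous P (X.poset k) (X.poset k) (X.·-continuousʳ k l) (e-continuous k))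
      }

-- The one-point Kegelspitze.

terminal : ∀ ℓ → Terminal (KS-Scott ℓ)
terminal ℓ = record
  { ⊤ = reflectedKegelspitze
      {P = ≡-poset ℓ} (λ s dir → _ , record { upper = λ _ → ≡.refl ; least = λ _ _ → ≡.refl })
      -- The empty family reflects the order because any two points are equal; eta for the unit type
      -- fills the underscores.
      {K = Empty} (λ ()) {e = λ ()} (λ ()) (λ _ → ≡.refl) _ (λ ()) _ (λ ())
  ; ! = λ {A} → record { continuous = const-continuous (Kegelspitze.poset A) (≡-poset ℓ) _ }
  ; !-unique = λ _ _ → ≡.refl
  }

-- Binary products.

module _ (A B : Kegelspitze ℓ) where
  private
    module A = Kegelspitze A
    module B = Kegelspitze B

    A×B-poset = ×-poset A.poset B.poset

    factor : Bool → Kegelspitze ℓ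
    factor b = if b then A else B

    projection : ∀ b → A.Carrier × B.Carrier → Kegelspitze.Carrier (factor b)
    projection true  = proj₁
    projection false = proj₂

    projection-continuous : ∀ b →
      IsScottContinuous ℓ A×B-poset (Kegelspitze.poset (factor b)) (projection b)
    projection-continuous true  = proj₁-continuous A.poset B.poset
    projection-continuous false = proj₂-continuous A.poset B.poset

    projection-reflects : JointlyReflects A×B-poset (Kegelspitze.poset ∘ factor) projection
    projection-reflects x≤y = x≤y true , x≤y false

    ×-isDcpo : IsDcpo A×B-poset ℓ
    ×-isDcpo s dir = (proj₁ a , proj₁ b) , record
      { upper = λ i → IsLub.upper (proj₂ a) i , IsLub.upper (proj₂ b) i
      ; least = λ z s≤z → IsLub.least (proj₂ a) (proj₁ z) (proj₁ ∘ s≤z)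
                        , IsLub.least (proj₂ b) (proj₂ z) (proj₂ ∘ s≤z)
      }
      where
      a = A.isDcpo (proj₁ ∘ s) (mono⇒directed A×B-poset A.poset proj₁ dir)
      b = B.isDcpo (proj₂ ∘ s) (mono⇒directed A×B-poset B.poset proj₂ dir)

  ×-kegelspitze : Kegelspitze ℓ
  ×-kegelspitze = reflectedKegelspitze ×-isDcpo factor projection-continuous projection-reflects
    (λ r x → A.⨁ r (proj₁ ∘ x) , B.⨁ r (proj₂ ∘ x))
    -- Splitting on the index lets `projection` compute; both sides then coincide definitionally.
    (λ { true _ _ → A.Eq.refl ; false _ _ → B.Eq.refl })
    (A.⊥ , B.⊥)
    (λ { true → A.Eq.refl ; false → B.Eq.refl })

  pair-continuous : ∀ (R : Poset c ℓ₁ ℓ₂) {f g} →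
    IsScottContinuous ℓ R A.poset f → IsScottContinuous ℓ R B.poset g →
    IsScottContinuous ℓ R A×B-poset (λ z → f z , g z)
  pair-continuous R f-cts g-cts =
    reflects⇒continuous A×B-poset (Kegelspitze.poset ∘ factor) R
      (λ b → IsScottContinuous.mono (projection-continuous b)) projection-reflects
      λ { true → f-cts ; false → g-cts }

  product : Product (KS-Scott ℓ) A B
  product = record
    { A×B = ×-kegelspitze
    ; π₁ = record { continuous = proj₁-continuous A.poset B.poset }
    ; π₂ = record { continuous = proj₂-continuous A.poset B.poset }
    ; ⟨_,_⟩ = λ {C} f g → record
      { continuous = pair-continuous (Kegelspitze.poset C)
          (ScottMap.continuous f) (ScottMap.continuous g) }
    ; project₁ = λ _ _ _ → A.Eq.refl
    ; project₂ = λ _ _ _ → B.Eq.refl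
    ; unique = λ _ _ _ p q z → p z , q z
    }

-- Function spaces and exponentials.

module _ (em : ExcludedMiddle (suc ℓ)) where

  -- Lowers the universe level of a predicate, so that the function space is
  -- again a Kegelspitze at level ℓ.
  Resize : Set (suc ℓ) → Set ℓ
  Resize S = Lift ℓ (True (em {S}))

  module _ (A B : Kegelspitze ℓ) where
    private
      module A = Kegelspitze A
      module B = Kegelspitze B

    record _⇒_ : Set ℓ where
      constructor mk⇒
      field
        app : A.Carrier → B.Carrier
        isContinuous : Resize (IsScottContinuous ℓ A.poset B.poset app)

    open _⇒_

    app-continuous : ∀ f → IsScottContinuous ℓ A.poset B.poset (app f)
    app-continuous f = toWitness (lower (isContinuous f))

    private
      module app f = IsScottContinuous (app-continuous f)

    lam : ∀ f → IsScottContinuous ℓ A.poset B.poset f → _⇒_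
    lam f f-cts = mk⇒ f (lift (fromWitness f-cts))

    ⇒-poset : Poset ℓ ℓ ℓ
    ⇒-poset = record
      { Carrier = _⇒_
      ; _≈_ = λ f g → ∀ a → app f a B.≈ app g a
      ; _≤_ = λ f g → ∀ a → app f a B.≤ app g a
      ; isPartialOrder = record
        { isPreorder = record
          { isEquivalence = record
            { refl = λ _ → B.Eq.refl
            ; sym = λ f≈g a → B.Eq.sym (f≈g a)
            ; trans = λ f≈g g≈h a → B.Eq.trans (f≈g a) (g≈h a)
            }
          ; reflexive = λ f≈g a → B.reflexive (f≈g a)
          ; trans = λ f≤g g≤h a → B.trans (f≤g a) (g≤h a)
          }
        ; antisym = λ f≤g g≤f a → B.antisym (f≤g a) (g≤f a)
        }
      }

    module _ {I : Set ℓ} (s : I → _⇒_) (dir : IsDirected ⇒-poset s) where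
      private
        ⨆ : ∀ a → ∃ (IsLub B.poset (λ i → app (s i) a))
        ⨆ a = B.isDcpo _ (mono⇒directed ⇒-poset B.poset (λ f≤g → f≤g a) dir)

        module ⨆ a = IsLub (proj₂ (⨆ a))

        -- The supremum over the maps `s i` and the supremum over the points `t j` can be exchanged.
        ⨆-continuous : IsScottContinuous ℓ A.poset B.poset (proj₁ ∘ ⨆)
        ⨆-continuous = mono∧lub⇒continuous A.poset B.poset ⨆-mono λ t t-dir a lub → record
          { upper = λ j → ⨆-mono (IsLub.upper lub j)
          ; least = λ b t≤b → ⨆.least a b λ i →
              IsLub.least (app.preservesLub (s i) t t-dir a lub) b λ j →
                B.trans (⨆.upper (t j) i) (t≤b j)
          }
          where
          ⨆-mono : Monotonic₁ A._≤_ B._≤_ (proj₁ ∘ ⨆)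
          ⨆-mono {x} {y} x≤y = ⨆.least x _ λ i → B.trans (app.mono (s i) x≤y) (⨆.upper y i)

      pointwiseSup : _⇒_
      pointwiseSup = lam (proj₁ ∘ ⨆) ⨆-continuous

      pointwiseSup-pointwise : ∀ a → IsLub B.poset (λ i → app (s i) a) (app pointwiseSup a)
      pointwiseSup-pointwise a = proj₂ (⨆ a)

      pointwiseSup-lub : IsLub ⇒-poset s pointwiseSup
      pointwiseSup-lub = record
        { upper = λ i a → ⨆.upper a i
        ; least = λ f s≤f a → ⨆.least a _ (λ i → s≤f i a)
        }

    -- Any least upper bound `f` of `s` lies below `pointwiseSup`, whose value at `a` is a supremum
    -- by construction.
    app-at-continuous : ∀ a → IsScottContinuous ℓ ⇒-poset B.poset (λ f → app f a)
    app-at-continuous a = mono∧lub⇒continuous ⇒-poset B.poset (λ f≤g → f≤g a)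
      λ s dir f lub → record
      { upper = λ i → IsLub.upper lub i a
      ; least = λ b s≤b → B.trans
          (IsLub.least lub (pointwiseSup s dir) (IsLub.upper (pointwiseSup-lub s dir)) a)
          (IsLub.least (pointwiseSup-pointwise s dir a) b s≤b)
      }

    ⇒-kegelspitze : Kegelspitze ℓ
    ⇒-kegelspitze = reflectedKegelspitze
      (λ s dir → pointwiseSup s dir , pointwiseSup-lub s dir)
      (const B) app-at-continuous id
      (λ {m} r f → lam (λ a → B.⨁ r (λ i → app (f i) a))
        (∘-continuous A.poset (B.poset ^ m) B.poset (B.⨁-continuous r)
          (tuple-continuous (λ i → app-continuous (f i)))))
      (λ _ _ _ → B.Eq.refl)
      (lam (const B.⊥) (const-continuous A.poset B.poset B.⊥))
      (λ _ → B.Eq.refl)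
      where
      tuple-continuous : ∀ {m} {f : Fin m → A.Carrier → B.Carrier} →
        (∀ i → IsScottContinuous ℓ A.poset B.poset (f i)) →
        IsScottContinuous ℓ A.poset (B.poset ^ m) (λ a i → f i a)
      tuple-continuous {m} = reflects⇒continuous (B.poset ^ m) (const B.poset) A.poset
        {e = λ k x → x k} (λ k x≤y → x≤y k) id

    -- Continuity in the point and then in the map reduces a bound on `app f a` to bounds on the
    -- mixed values of the `i`-th map at the `j`-th point.
    eval-continuous : IsScottContinuous ℓ (×-poset ⇒-poset A.poset) B.poset (λ (f , a) → app f a)
    eval-continuous = mono∧lub⇒continuous ⇒×A B.poset (λ {x} {y} → eval-mono x y)
      λ s dir (f , a) lub → record
      { upper = λ i → eval-mono (s i) (f , a) (IsLub.upper lub i)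
      ; least = λ b s≤b →
          let f-dir = mono⇒directed ⇒×A ⇒-poset {f = proj₁} proj₁ dir
              a-dir = mono⇒directed ⇒×A A.poset {f = proj₂} proj₂ dir
              f-lub = IsScottContinuous.preservesLub (proj₁-continuous ⇒-poset A.poset) s dir _ lub
              a-lub = IsScottContinuous.preservesLub (proj₂-continuous ⇒-poset A.poset) s dir _ lub
          in IsLub.least (app.preservesLub f (proj₂ ∘ s) a-dir a a-lub) b λ j →
             let aⱼ = proj₂ (s j)
             in IsLub.least (IsScottContinuous.preservesLub (app-at-continuous aⱼ)
                  (proj₁ ∘ s) f-dir f f-lub) b λ i →
                -- Directedness puts the mixed value below the diagonal value at `k`, which `b`
                -- bounds.
                let k , i≤k , j≤k = IsDirected.semidirected dir i j
                in B.trans (eval-mono (proj₁ (s i) , aⱼ) (s k) (proj₁ i≤k , proj₂ j≤k)) (s≤b k)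
      }
      where
      ⇒×A = ×-poset ⇒-poset A.poset

      eval-mono : ∀ ((f , a) (g , a′) : Poset.Carrier ⇒×A) →
                  Poset._≤_ ⇒×A (f , a) (g , a′) → app f a B.≤ app g a′
      eval-mono (f , a) (g , a′) (f≤g , a≤a′) = B.trans (f≤g a) (app.mono g a≤a′)

    exponential : Exponential (KS-Scott ℓ) product A B
    exponential = record
      { B^A = ⇒-kegelspitze
      ; eval = record { continuous = eval-continuous }
      ; curry = λ {C} f →
          let module C = Kegelspitze C
              C×A = ×-poset C.poset A.poset
              f-cts = ScottMap.continuous f
          in record
          { fun = λ c → lam (λ a → ScottMap.fun f (c , a))
              (∘-continuous A.poset C×A B.poset f-cts (pair-continuous C A A.poset
                (const-continuous A.poset C.poset c) (id-continuous A.poset)))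
          -- Continuity in `c` is tested by evaluating at each `a`, which leaves `f` after
          -- `c ↦ (c , a)`.
          ; continuous = reflects⇒continuous ⇒-poset (const B.poset) C.poset
              {e = λ a g → app g a} (λ a g≤h → g≤h a) id
              λ a → ∘-continuous C.poset C×A B.poset f-cts (pair-continuous C A C.poset
                (id-continuous C.poset) (const-continuous C.poset A.poset a))
          }
      ; β = λ _ _ → B.Eq.refl
      ; unique = λ _ _ k≈f c a → k≈f (c , a)
      }

proposition2p7 : ∀ {ℓ} → ExcludedMiddle (suc ℓ) → CartesianClosed (KS-Scott ℓ)
proposition2p7 {ℓ} em = record
  { terminal = terminal ℓ
  ; product = product
  ; exponential = exponential em
  }
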